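{- On binary strings, Algorithm RDuval (described in the context) executes in $O(n\log_{4/3} n)$ time on average; that is, the average of its running time over all strings $x \in \{a,b\}^n$ is $O(n \log_{4/3} n)$.
   Context: A Lyndon word is a nonempty primitive string (not of the form $u^e$ with $e>1$) that is lexicographically least among all its rotations. The Lyndon decomposition of a nonempty string $x$ is its unique factorization $x = w_1w_2\cdots w_k$ into Lyndon words with $w_1 \ge w_2 \ge \cdots \ge w_k$; Duval's algorithm computes it in time linear in $|x|$. The Lyndon array $\lambda[1..n]$ of $x[1..n]$ is given by: $\lambda[i]$ is the length of the longest Lyndon word that is a substring of $x$ starting at position $i$. Algorithm RDuval computes $\lambda$ as follows. Compute the Lyndon decomposition $x = w_1w_2\cdots w_k$ (by Duval's linear-time algorithm) and, for each $j$, set $\lambda[i_j] \leftarrow |w_j|$, where $i_j$ is the position in $x$ of the first letter of $w_j$. Then remove the first letter from each $w_j$ to form $w'_j$, and apply the same procedure recursively to each nonempty $w'_j$ (positions being those in the original string). The process continues until each Lyndon word has been reduced to a single letter. -}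

module Defs where

open import Data.Bool.Base using (Bool; true; false)
open import Data.Bool.Properties using (<-cmp)
open import Data.Integer.Base using (+_; -[1+_])
open import Data.List.Base using (List; []; _∷_; _++_; length; take; drop; map)
open import Data.List.NonEmpty.Base as List⁺ using (List⁺; _∷_)
open import Data.List.Properties using (length-take; length-drop)
open import Data.List.Relation.Unary.All as All using (All; []; _∷_)
open import Data.Nat.Base using (ℕ; zero; suc; _+_; _∸_; _*_; _^_; _≤_; _<_; s≤s)
open import Data.Nat.ListAction using (sum)
open import Data.Nat.Induction using (Acc; acc; <-wellFounded)
open import Data.Nat.Properties
  using (_≤?_; ≤-trans; ≤-reflexive; <⇒≤; m∸n≤m; m⊓n≤n; m^n≢0)
open import Data.Product.Base using (∃; _×_; _,_)
open import Data.Rational.Unnormalised.Base using (ℚᵘ; mkℚᵘ; _/_)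
open import Data.Unit.Base using (⊤; tt)
open import Relation.Binary.Definitions using (tri<; tri≈; tri>)
open import Relation.Binary.PropositionalEquality using (_≡_; refl)
open import Relation.Nullary.Decidable using (yes; no)

-- A computation together with the number of elementary steps it performs.

record Timed (A : Set) : Set where
  constructor _after_
  field
    value : A
    time  : ℕ

open Timed public

return : ∀ {A} → A → Timed A
return x = x after 0

tick : Timed ⊤
tick = tt after 1

infixl 1 _>>=_ _>>_

_>>=_ : ∀ {A B} → Timed A → (A → Timed B) → Timed B
m >>= f = value (f (value m)) after (time m + time (f (value m)))

_>>_ : ∀ {A B} → Timed A → Timed B → Timed B
m >> m′ = m >>= λ _ → m′

-- Make a property of the result available to the rest of the computation.

attach : ∀ {A} {P : A → Set} (m : Timed A) → P (value m) → Timed (∃ P)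
attach m p = (value m , p) after time m

-- Strings over {a, b}, with a < b.

pattern a = false
pattern b = true

Word : Set
Word = List Bool

-- The cost model is the unit-cost random access machine.  Words occurring in
-- the algorithms are substrings of the input array, so that "take", "drop",
-- moving to the next letter and passing a list of factors on stand for O(1)
-- operations on positions.  Each pass through a loop costs one tick.

-- Duval's algorithm, with its usual three indices i ≤ k < j:
--
--   i ← 1
--   while i ≤ n:
--     j ← i + 1;  k ← i
--     while j ≤ n and x[k] ≤ x[j]:
--       if x[k] < x[j] then k ← i else k ← k + 1
--       j ← j + 1
--     while i ≤ k:
--       output x[i .. i + (j - k) - 1];  i ← i + (j - k)
--
-- An index is represented by the suffix of x that starts there.  In addition
-- to the suffixes at i, k and j we keep the numbers k - i and q = (j - k) - 1;
-- the subtraction of 1 makes it evident that the period j - k is positive.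

-- The first inner loop; it returns the final k - i and (j - k) - 1.

scan : (xᵢ xₖ xⱼ : Word) (k q : ℕ) → Timed (ℕ × ℕ)
scan xᵢ xₖ [] k q = do
  tick
  return (k , q)
scan xᵢ [] (d ∷ xⱼ) k q = return (k , q) -- unreachable, since k < j
scan xᵢ (c ∷ xₖ) (d ∷ xⱼ) k q with <-cmp c d
... | tri< _ _ _ = do
  tick
  scan xᵢ xᵢ xⱼ 0 (k + suc q)
... | tri≈ _ _ _ = do
  tick
  scan xᵢ xₖ xⱼ (suc k) q
... | tri> _ _ _ = do
  tick
  return (k , q)

drop-< : ∀ q (s : Word) → length (drop q s) < suc (length s)
drop-< q s = s≤s (≤-trans (≤-reflexive (length-drop q s)) (m∸n≤m (length s) q))

take-≤ : ∀ q (s : Word) → length (take q s) ≤ length s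
take-≤ q s = ≤-trans (≤-reflexive (length-take q s)) (m⊓n≤n q (length s))

mutual

  -- The outer loop.

  factors : (x : Word) → Acc _<_ (length x) → Timed (List (List⁺ Bool))
  factors []      _  = return []
  factors (c ∷ s) ac = do
    tick
    k , q ← scan (c ∷ s) (c ∷ s) s 0 0
    emit k q (c ∷ s) ac

  -- The second inner loop, from a state in which i ≤ k, followed by the
  -- remaining passes of the outer loop.  Its first argument is k - i.

  emit : (k q : ℕ) (xᵢ : Word) → Acc _<_ (length xᵢ) → Timed (List (List⁺ Bool))
  emit k q []      _        = return [] -- unreachable, since i ≤ k
  emit k q (c ∷ s) (acc rs) with suc q ≤? k
  ... | yes _ = do
    tick
    ws ← emit (k ∸ suc q) q (drop q s) (rs (drop-< q s))
    return ((c ∷ take q s) ∷ ws)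
  ... | no _ = do
    tick
    ws ← factors (drop q s) (rs (drop-< q s))
    return ((c ∷ take q s) ∷ ws)

duval : Word → Timed (List (List⁺ Bool))
duval x = factors x (<-wellFounded (length x))

-- No factor is longer than the word; this is what makes RDuval terminate.

Bounded : ℕ → List (List⁺ Bool) → Set
Bounded n = All (λ w → List⁺.length w ≤ n)

weaken : ∀ q s {ws} → Bounded (length (drop q s)) ws → Bounded (suc (length s)) ws
weaken q s = All.map (λ p → ≤-trans p (<⇒≤ (drop-< q s)))

mutual

  factors-bounded : ∀ x ac → Bounded (length x) (value (factors x ac))
  factors-bounded []      _  = []
  factors-bounded (c ∷ s) ac = emit-bounded _ _ (c ∷ s) ac

  emit-bounded : ∀ k q x ac → Bounded (length x) (value (emit k q x ac))
  emit-bounded k q []      _        = []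
  emit-bounded k q (c ∷ s) (acc rs) with suc q ≤? k
  ... | yes _ = s≤s (take-≤ q s) ∷ weaken q s (emit-bounded _ q (drop q s) _)
  ... | no _  = s≤s (take-≤ q s) ∷ weaken q s (factors-bounded (drop q s) _)

duval-bounded : ∀ x → Bounded (length x) (value (duval x))
duval-bounded x = factors-bounded x _

-- The result of RDuval is the array λ.  The entries of λ for the positions
-- of a factor c ∷ w′ are its length, for the position of c, followed by those
-- computed from w′, so writing the entries in place amounts to concatenation.

mutual

  rduval : (x : Word) → Acc _<_ (length x) → Timed (List ℕ)
  rduval []         _  = return []
  rduval x@(_ ∷ _) (acc rs) = do
    ws , bounded ← attach (duval x) (duval-bounded x)
    reduce rs ws bounded

  reduce : ∀ {n} → (∀ {m} → m < n → Acc _<_ m) →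
           (ws : List (List⁺ Bool)) → Bounded n ws → Timed (List ℕ)
  reduce rs []              []       = return []
  reduce rs ((c ∷ w′) ∷ ws) (p ∷ ps) = do
    tick -- set the entry for c
    tick -- remove c
    λs  ← rduval w′ (rs p)
    λs′ ← reduce rs ws ps
    return (suc (length w′) ∷ λs ++ λs′)

RDuval : Word → Timed (List ℕ)
RDuval x = rduval x (<-wellFounded (length x))

_ : value (RDuval (b ∷ a ∷ a ∷ b ∷ a ∷ b ∷ a ∷ a ∷ b ∷ a ∷ []))
    ≡ 1 ∷ 5 ∷ 2 ∷ 1 ∷ 2 ∷ 1 ∷ 3 ∷ 2 ∷ 1 ∷ 1 ∷ []
_ = refl

-- The 2 ^ n words of length n.

words : ℕ → List Word
words zero    = [] ∷ []
words (suc n) = map (a ∷_) (words n) ++ map (b ∷_) (words n)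

averageTime : ℕ → ℚᵘ
averageTime n = (+ sum (map (λ x → time (RDuval x)) (words n))) / (2 ^ n)
  where instance _ = m^n≢0 2 n

-- r ≤ m ·log[4/3] n  is the inequality of real numbers r ≤ m · log_{4/3} n,
-- for n ≥ 1.  With r = p / d it says that (4/3)^p ≤ n^(m·d); it is stated with
-- the powers of 3 and 4 moved to the sides where their exponents are natural.

infix 4 _≤_·log[4/3]_

_≤_·log[4/3]_ : ℚᵘ → ℕ → ℕ → Set
mkℚᵘ (+ p)    d-1 ≤ m ·log[4/3] n = 4 ^ p ≤ 3 ^ p * n ^ (m * suc d-1)
mkℚᵘ -[1+ p ] d-1 ≤ m ·log[4/3] n = 3 ^ suc p ≤ 4 ^ suc p * n ^ (m * suc d-1)

-- The factors that RDuval finds are Lyndon words, and no run of a's in a Lyndon word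
-- is longer than the run it starts with.  Let span y be the length of the longest
-- prefix of y with this property.  Duval's algorithm takes linear time, so the time
-- of RDuval on x is of the order of the total length of the factors found, over all
-- levels of the recursion.  Each position of x starts exactly one of them, hence the
-- total is at most the sum of the spans of the suffixes of x.  In a random word, the
-- leading run has length k with probability 2 ^ (− k − 1), and the expected waiting
-- time for a longer run is less than 2 ^ (k + 2); so each k ≤ log₂ n contributes O(1)
-- to the expected span, the k > log₂ n contribute O(1) together, and the expected span
-- is O(log n).

module Submission where

open import Data.Bool.Base using (Bool)
open import Data.Empty using (⊥-elim)
import Data.Integer.Base as ℤ
open import Data.List.Base using (List; []; _∷_; [_]; _++_; length; take; drop; map; replicate; concat)
open import Data.List.NonEmpty.Base as List⁺ using (List⁺; _∷_)
open import Data.List.Properties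
  using (∷-injective; ++-assoc; length-++; length-replicate; map-++; map-∘; take++drop≡id)
open import Data.List.Relation.Unary.All using (All; []; _∷_)
open import Data.Nat.Base hiding (_/_)
open import Data.Nat.Induction using (Acc; acc; <-wellFounded)
open import Data.Nat.ListAction using (sum)
open import Data.Nat.ListAction.Properties using (sum-++)
open import Data.Nat.Properties
open import Data.Nat.Tactic.RingSolver using (solve-∀)
open import Data.Product.Base using (∃-syntax; _×_; _,_; proj₁; proj₂)
open import Data.Rational.Unnormalised.Base using (_/_)
open import Function.Base using (_∘_)
open import Relation.Binary.PropositionalEquality
  using (_≡_; refl; sym; trans; cong; cong₂; subst; subst₂; module ≡-Reasoning)
open import Relation.Nullary.Decidable using (yes; no)
open import Defs

-- Spans of words and of their suffixes

-- run K r y is the number of letters of y before a run of more than K a's is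
-- completed, when the run in progress admits r more a's.  In span m y, the bound
-- K is the length of the leading run, of which m letters precede y.
run : (K r : ℕ) → Word → ℕ
run K r       []      = 0
run K zero    (a ∷ y) = 0
run K (suc r) (a ∷ y) = suc (run K r y)
run K r       (b ∷ y) = suc (run K K y)

span : (m : ℕ) → Word → ℕ
span m []      = 0
span m (a ∷ y) = suc (span (suc m) y)
span m (b ∷ y) = suc (run m m y)

spans : Word → ℕ
spans []          = 0
spans x@(_ ∷ x′) = span 0 x + spans x′

run-b : ∀ K r y → run K r (b ∷ y) ≡ suc (run K K y)
run-b K zero    y = refl
run-b K (suc r) y = refl

run-++ : ∀ K r u v → run K r u ≤ run K r (u ++ v)
run-++ K r       []      v = z≤n
run-++ K zero    (a ∷ u) v = z≤n
run-++ K (suc r) (a ∷ u) v = s≤s (run-++ K r u v)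
run-++ K zero    (b ∷ u) v = s≤s (run-++ K K u v)
run-++ K (suc r) (b ∷ u) v = s≤s (run-++ K K u v)

span-++ : ∀ m u v → span m u ≤ span m (u ++ v)
span-++ m []      v = z≤n
span-++ m (a ∷ u) v = s≤s (span-++ (suc m) u v)
span-++ m (b ∷ u) v = s≤s (run-++ m m u v)

-- Appending letters never shortens the span of a suffix, so the spans of consecutive factors may be
-- added up.
spans-++ : ∀ u v → spans u + spans v ≤ spans (u ++ v)
spans-++ []      v = ≤-refl
spans-++ (c ∷ u) v = begin
  span 0 (c ∷ u) + spans u + spans v      ≡⟨ +-assoc (span 0 (c ∷ u)) _ _ ⟩
  span 0 (c ∷ u) + (spans u + spans v)    ≤⟨ +-mono-≤ (span-++ 0 (c ∷ u) v) (spans-++ u v) ⟩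
  span 0 (c ∷ u ++ v) + spans (u ++ v)    ∎
  where open ≤-Reasoning

run-prefix : ∀ K r u v → length u ≤ run K r (u ++ v) → length u ≤ run K r u
run-prefix K r       []      v p       = z≤n
run-prefix K (suc r) (a ∷ u) v (s≤s p) = s≤s (run-prefix K r u v p)
run-prefix K zero    (b ∷ u) v (s≤s p) = s≤s (run-prefix K K u v p)
run-prefix K (suc r) (b ∷ u) v (s≤s p) = s≤s (run-prefix K K u v p)

-- A span that covers `u` has met no longer run inside `u`, whatever follows.
span-prefix : ∀ m u v → length u ≤ span m (u ++ v) → length u ≤ span m u
span-prefix m []      v p       = z≤n
span-prefix m (a ∷ u) v (s≤s p) = s≤s (span-prefix (suc m) u v p)
span-prefix m (b ∷ u) v (s≤s p) = s≤s (run-prefix m m u v p)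

-- The scanning loop of Duval's algorithm

-- Satisfied by Lyndon words, and all that is needed of them.
LeadingRunLongest : Word → Set
LeadingRunLongest w = length w ≤ span 0 w

-- The indices i ≤ k < j of Duval's algorithm cut x[i ..] = t x[k ..] = u t x[j ..],
-- so that t is a border of u t.
record Border (xᵢ xₖ xⱼ : Word) (k q : ℕ) : Set where
  constructor border
  field
    t u      : Word
    at-k     : xᵢ ≡ t ++ xₖ
    at-j     : xᵢ ≡ u ++ t ++ xⱼ
    length-t : length t ≡ k
    length-u : length u ≡ suc q

-- As `k + suc q` is j - i after the scan and `advanced` is j - i before it, the inequality says
-- that all passes but at most one move j forward.
ScanSpec : Word → ℕ → Timed (ℕ × ℕ) → Set
ScanSpec x advanced m = let k , q = value m in
  ∃[ xₖ ] ∃[ xⱼ ] ∃[ β ] LeadingRunLongest (Border.u {x} {xₖ} {xⱼ} {k} {q} β) ×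
  time m + advanced ≤ suc (k + suc q)

-- The period is a prefix of `x` no longer than j - i, and the span of `x` reaches j.
period-run : ∀ {x xₖ xⱼ k q n} (β : Border x xₖ xⱼ k q) →
  span 0 x ≡ k + suc q + n → LeadingRunLongest (Border.u β)
period-run {k = k} {q} {n} (border t u _ refl _ length-u) x≡ = span-prefix 0 u _ (begin
  length u              ≡⟨ length-u ⟩
  suc q                 ≤⟨ m≤n+m (suc q) k ⟩
  k + suc q             ≤⟨ m≤m+n _ n ⟩
  k + suc q + n         ≡⟨ x≡ ⟨
  span 0 (u ++ t ++ _)  ∎)
  where open ≤-Reasoning

next-equal : ∀ {x c xₖ xⱼ k q} → Border x (c ∷ xₖ) (c ∷ xⱼ) k q → Border x xₖ xⱼ (suc k) q
next-equal {c = c} {xₖ} {xⱼ} {k} (border t u at-k at-j length-t length-u) = border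
  (t ++ [ c ]) u
  (trans at-k (sym (++-assoc t [ c ] xₖ)))
  (trans at-j (cong (u ++_) (sym (++-assoc t [ c ] xⱼ))))
  (trans (length-++ t) (trans (+-comm (length t) 1) (cong suc length-t)))
  length-u

-- Used when x[k] < x[j]: k returns to i, the border becomes empty, and the new period is all of
-- x[i .. j].
next-greater : ∀ {x xₖ d xⱼ k q} → Border x xₖ (d ∷ xⱼ) k q → Border x x xⱼ 0 (k + suc q)
next-greater {d = d} {xⱼ} {k} {q} (border t u at-k at-j length-t length-u) = border
  [] (u ++ t ++ [ d ])
  refl
  (trans at-j (trans (cong (u ++_) (sym (++-assoc t [ d ] xⱼ))) (sym (++-assoc u _ xⱼ))))
  refl
  (begin
    length (u ++ t ++ [ d ])            ≡⟨ length-++ u ⟩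
    length u + length (t ++ [ d ])      ≡⟨ cong (length u +_) (length-++ t) ⟩
    length u + (length t + 1)           ≡⟨ cong₂ (λ m n → m + (n + 1)) length-u length-t ⟩
    suc q + (k + 1)                     ≡⟨ eq q k ⟩
    suc (k + suc q)                     ∎)
  where
  open ≡-Reasoning
  eq : ∀ q k → suc q + (k + 1) ≡ suc (k + suc q)
  eq = solve-∀

advance : ∀ {x m} n → ScanSpec x (suc n) m → ScanSpec x n (tick >> m)
advance n (xₖ , xⱼ , β , p , le) =
  xₖ , xⱼ , β , p , ≤-trans (≤-reflexive (sym (+-suc _ n))) le

-- The invariant s ≤ r says that the run of a's just before x[j] is no longer than the
-- one just before x[k]; it persists because the loop goes on only while x[k] ≤ x[j].
scan-run : ∀ K s r x xₖ xⱼ k q → Border x xₖ xⱼ k q →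
  span 0 x ≡ run K K x →
  span 0 x ≡ k + run K s xₖ →
  span 0 x ≡ k + suc q + run K r xⱼ →
  s ≤ r →
  ScanSpec x (k + suc q) (scan x xₖ xⱼ k q)
scan-run K s r x xₖ [] k q β x≡ k≡ j≡ s≤r = xₖ , [] , β , period-run β j≡ , ≤-refl
scan-run K s r x [] (d ∷ xⱼ) k q β x≡ k≡ j≡ s≤r = [] , _ , β , period-run β j≡ , n≤1+n _
scan-run K s r x (b ∷ xₖ) (a ∷ xⱼ) k q β x≡ k≡ j≡ s≤r = _ , _ , β , period-run β j≡ , ≤-refl
scan-run K s r x (a ∷ xₖ) (b ∷ xⱼ) k q β x≡ k≡ j≡ s≤r = advance (k + suc q)
  (scan-run K K K x x xⱼ 0 (k + suc q) (next-greater β) x≡ x≡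
    (trans j≡ (trans (cong (k + suc q +_) (run-b K r xⱼ)) (+-suc (k + suc q) _))) ≤-refl)
scan-run K s r x (b ∷ xₖ) (b ∷ xⱼ) k q β x≡ k≡ j≡ s≤r = advance (k + suc q)
  (scan-run K K K x xₖ xⱼ (suc k) q (next-equal β) x≡
    (trans k≡ (trans (cong (k +_) (run-b K s xₖ)) (+-suc k _)))
    (trans j≡ (trans (cong (k + suc q +_) (run-b K r xⱼ)) (+-suc (k + suc q) _))) ≤-refl)
scan-run K zero r x (a ∷ xₖ) (a ∷ xⱼ) k q β x≡ k≡ j≡ s≤r =
  -- With `s` = 0 the span of `x` would end at k, yet it reaches j > k.
  ⊥-elim (<-irrefl (sym (trans k≡ (+-identityʳ k))) (begin-strict
    k                                   <⟨ m<m+n k z<s ⟩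
    k + suc q                           ≤⟨ m≤m+n _ _ ⟩
    k + suc q + run K r (a ∷ xⱼ)        ≡⟨ j≡ ⟨
    span 0 x                            ∎))
  where open ≤-Reasoning
scan-run K (suc s) (suc r) x (a ∷ xₖ) (a ∷ xⱼ) k q β x≡ k≡ j≡ (s≤s s≤r) = advance (k + suc q)
  (scan-run K s r x xₖ xⱼ (suc k) q (next-equal β) x≡
    (trans k≡ (+-suc k _)) (trans j≡ (+-suc (k + suc q) _)) s≤r)

replicate-∷ : ∀ {A : Set} k (c : A) y → replicate k c ++ c ∷ y ≡ c ∷ replicate k c ++ y
replicate-∷ zero    c y = refl
replicate-∷ (suc k) c y = cong (c ∷_) (replicate-∷ k c y)

span-replicate : ∀ m k y → span m (replicate k a ++ b ∷ y) ≡ suc (k + run (k + m) (k + m) y)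
span-replicate m zero    y = refl
span-replicate m (suc k) y rewrite sym (+-suc k m) = cong suc (span-replicate (suc m) k y)

run-replicate : ∀ K k y → run K k (replicate k a ++ b ∷ y) ≡ suc (k + run K K y)
run-replicate K zero    y = refl
run-replicate K (suc k) y = cong suc (run-replicate K k y)

-- Treats the leading run, during which `span` has not yet fixed its bound: all letters read are
-- a's, with period 1. The first b sets K to `suc k`, and `scan-run` takes over.
scan-replicate : ∀ k {x} xⱼ → x ≡ replicate k a ++ a ∷ xⱼ →
  ScanSpec x (k + 1) (scan x (a ∷ xⱼ) xⱼ k 0)
scan-replicate k []      refl = _ , [] ,
  border (replicate k a) [ a ] refl (replicate-∷ k a []) (length-replicate k) refl ,
  s≤s z≤n , ≤-refl
scan-replicate k (a ∷ y) x≡ = advance (k + 1)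
  (scan-replicate (suc k) y (trans x≡ (replicate-∷ k a (a ∷ y))))
scan-replicate k {x} (b ∷ y) x≡ = advance (k + 1)
  (scan-run (suc k) (suc k) (suc k) x x y 0 (k + 1)
    (next-greater (border (replicate k a) [ a ] x≡ x≡′ (length-replicate k) refl))
    (trans span≡ (sym (trans (cong (run (suc k) (suc k)) x≡′) (run-replicate (suc k) (suc k) y))))
    (trans span≡ (sym (trans (cong (run (suc k) (suc k)) x≡′) (run-replicate (suc k) (suc k) y))))
    (trans span≡ (cong (λ n → suc (n + run (suc k) (suc k) y)) (+-comm 1 k)))
    ≤-refl)
  where
  x≡′ : x ≡ replicate (suc k) a ++ b ∷ y
  x≡′ = trans x≡ (replicate-∷ k a (b ∷ y))
  span≡ : span 0 x ≡ suc (suc k + run (suc k) (suc k) y)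
  span≡ = trans (cong (span 0) x≡′) (trans (span-replicate 0 (suc k) y)
            (cong (λ K → suc (suc k + run K K y)) (+-identityʳ (suc k))))

scan-spec : ∀ c s → ScanSpec (c ∷ s) 1 (scan (c ∷ s) (c ∷ s) s 0 0)
scan-spec a s = scan-replicate 0 s refl
scan-spec b s = scan-run 0 0 0 (b ∷ s) (b ∷ s) s 0 0
  (border [] [ b ] refl refl refl refl) refl refl refl ≤-refl

-- Factors found by Duval's algorithm, and its linear time

prefix-split : ∀ u {v} q {s : Word} → s ≡ u ++ v → length u ≡ q → take q s ≡ u × drop q s ≡ v
prefix-split []      _ refl refl = refl , refl
prefix-split (c ∷ u) _ refl refl with prefix-split u _ refl refl
... | p , p′ = cong (c ∷_) p , p′

-- Two prefixes of one word are comparable. Cutting off a period `u` no longer than the border `t`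
-- leaves the border `t′`, with which the emission continues.
common-prefix : ∀ (u t : Word) {v y} → length u ≤ length t → u ++ v ≡ t ++ y →
  ∃[ t′ ] t ≡ u ++ t′ × v ≡ t′ ++ y
common-prefix []      t       _       refl = t , refl , refl
common-prefix (c ∷ u) (_ ∷ t) (s≤s p) eq with ∷-injective eq
... | refl , eq′ with common-prefix u t p eq′
...   | t′ , refl , v≡ = t′ , refl , v≡

letters : List⁺ Bool → Word
letters = List⁺.toList

Factorization : Word → List (List⁺ Bool) → Set
Factorization x ws = concat (map letters ws) ≡ x × All (LeadingRunLongest ∘ letters) ws

-- A scan that advances j by k + q + 1 is followed by the emission of factors of
-- total length at least max(k + 1, q + 1), to which its cost is charged.
FactorsSpec : Word → ℕ → Timed (List (List⁺ Bool)) → Set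
FactorsSpec x spent m = Factorization x (value m) × time m + spent ≤ 4 * length x

Factorization-∷ : ∀ {c s q ws} → LeadingRunLongest (c ∷ take q s) →
  Factorization (drop q s) ws → Factorization (c ∷ s) ((c ∷ take q s) ∷ ws)
Factorization-∷ {c} {s} {q} p (ws≡ , ps) =
  cong (c ∷_) (trans (cong (take q s ++_) ws≡) (take++drop≡id q s)) , p ∷ ps

length-split : ∀ {x y v : Word} {n} u → length u ≡ n → x ≡ u ++ v → y ≡ v →
  length y + n ≡ length x
length-split {v = v} u refl refl refl =
  trans (+-comm (length v) (length u)) (sym (length-++ u))

mutual

  factors-spec : ∀ x ac → FactorsSpec x 0 (factors x ac)
  factors-spec []      _  = (refl , []) , z≤n
  factors-spec (c ∷ s) ac with scan-spec c s
  ... | xₖ , xⱼ , β , p , t≤ with emit-spec _ _ (c ∷ s) ac β p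
  ...   | fact , t′≤ = fact , (begin
    suc (τ + τ′) + 0    ≡⟨ eq τ τ′ ⟩
    τ′ + (τ + 1)        ≤⟨ +-monoʳ-≤ τ′ t≤ ⟩
    τ′ + suc _          ≤⟨ t′≤ ⟩
    4 * length (c ∷ s)  ∎)
    where
    open ≤-Reasoning
    τ τ′ : ℕ
    τ  = time (scan (c ∷ s) (c ∷ s) s 0 0)
    τ′ = let k , q = value (scan (c ∷ s) (c ∷ s) s 0 0) in time (emit k q (c ∷ s) ac)
    eq : ∀ m n → suc (m + n) + 0 ≡ n + (m + 1)
    eq = solve-∀

  -- If `suc q ≤ k`, emitting a period lowers the debt by `suc q`; with its own tick it is charged
  -- `2 + q`. Otherwise `k ≤ q`, and the whole remaining debt plus a tick is at most `3 + 2 * q`.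
  -- Both are within 4 per emitted letter.
  emit-spec : ∀ k q x {xₖ xⱼ} ac (β : Border x xₖ xⱼ k q) → LeadingRunLongest (Border.u β) →
    FactorsSpec x (suc (k + suc q)) (emit k q x ac)
  emit-spec k q []      ac (border t [] _ _ _ ()) p
  emit-spec k q []      ac (border t (_ ∷ _) _ () _ _) p
  emit-spec k q (c ∷ s) {xₖ} {xⱼ} (acc rs) (border t u at-k at-j length-t length-u) p
    with prefix-split u (suc q) at-j length-u | suc q ≤? k
  ... | u≡ , s≡ | yes q<k
      with common-prefix u t {t ++ xⱼ} {xₖ} (subst₂ _≤_ (sym length-u) (sym length-t) q<k)
             (trans (sym at-j) at-k)
  ...   | t′ , t≡ , v≡
        with emit-spec (k ∸ suc q) q (drop q s) (rs (drop-< q s))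
               (border t′ u
                 (trans s≡ v≡)
                 (trans s≡ (trans (cong (_++ xⱼ) t≡) (++-assoc u t′ xⱼ)))
                 (trans (sym (m+n∸m≡n (length u) (length t′)))
                   (cong₂ _∸_ (trans (sym (trans (cong length t≡) (length-++ u))) length-t) length-u))
                 length-u)
               p
  ...     | fact , t≤ =
    Factorization-∷ (subst LeadingRunLongest (sym u≡) p) fact , (begin
      suc (τ + 0) + suc (k + suc q)                ≡⟨ cong (λ l → suc (τ + 0) + suc (l + suc q)) (m∸n+n≡m q<k) ⟨
      suc (τ + 0) + suc (k′ + suc q + suc q)       ≡⟨ eq τ k′ q ⟩
      (τ + suc (k′ + suc q)) + (2 + q)             ≤⟨ +-mono-≤ t≤ (≤-trans (m≤m+n (2 + q) _) (≤-reflexive (eq′ q))) ⟩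
      4 * length (drop q s) + 4 * suc q            ≡⟨ *-distribˡ-+ 4 (length (drop q s)) (suc q) ⟨
      4 * (length (drop q s) + suc q)              ≡⟨ cong (4 *_) (length-split u length-u at-j s≡) ⟩
      4 * suc (length s)                           ∎)
    where
    open ≤-Reasoning
    k′ τ : ℕ
    k′ = k ∸ suc q
    τ  = time (emit k′ q (drop q s) (rs (drop-< q s)))
    eq : ∀ τ k′ q → suc (τ + 0) + suc (k′ + suc q + suc q) ≡ (τ + suc (k′ + suc q)) + (2 + q)
    eq = solve-∀
    eq′ : ∀ q → 2 + q + (2 + 3 * q) ≡ 4 * suc q
    eq′ = solve-∀
  emit-spec k q (c ∷ s) {xₖ} {xⱼ} (acc rs) (border t u at-k at-j length-t length-u) p
    | u≡ , s≡ | no q≮k with factors-spec (drop q s) (rs (drop-< q s))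
  ...   | fact , t≤ =
    Factorization-∷ (subst LeadingRunLongest (sym u≡) p) fact , (begin
      suc (τ + 0) + suc (k + suc q)                ≤⟨ +-monoʳ-≤ (suc (τ + 0)) (s≤s (+-monoˡ-≤ (suc q) (≮⇒≥ q≮k))) ⟩
      suc (τ + 0) + suc (q + suc q)                ≡⟨ eq τ q ⟩
      τ + 0 + (3 + 2 * q)                          ≤⟨ +-mono-≤ t≤ (≤-trans (m≤m+n (3 + 2 * q) _) (≤-reflexive (eq′ q))) ⟩
      4 * length (drop q s) + 4 * suc q            ≡⟨ *-distribˡ-+ 4 (length (drop q s)) (suc q) ⟨
      4 * (length (drop q s) + suc q)              ≡⟨ cong (4 *_) (length-split u length-u at-j s≡) ⟩
      4 * suc (length s)                           ∎)
    where
    open ≤-Reasoning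
    τ : ℕ
    τ  = time (factors (drop q s) (rs (drop-< q s)))
    eq : ∀ τ q → suc (τ + 0) + suc (q + suc q) ≡ τ + 0 + (3 + 2 * q)
    eq = solve-∀
    eq′ : ∀ q → 3 + 2 * q + (1 + 2 * q) ≡ 4 * suc q
    eq′ = solve-∀

-- Time of RDuval in terms of spans

mutual

  -- The constant is 4 + 2: Duval's algorithm costs at most 4 per letter, and `reduce` spends 2
  -- ticks on each nonempty factor.
  rduval-time : ∀ x ac → time (rduval x ac) ≤ 6 * spans x
  rduval-time []      ac = z≤n
  rduval-time (c ∷ s) (acc rs) with factors-spec (c ∷ s) (<-wellFounded _)
  ... | (ws≡ , ps) , t≤ = begin
    τ + ρ                                   ≡⟨ +-comm τ ρ ⟩
    ρ + τ                                   ≤⟨ +-monoʳ-≤ ρ (≤-trans (m≤m+n τ 0) t≤) ⟩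
    ρ + 4 * length (c ∷ s)                  ≤⟨ subst (λ x → ρ + 4 * length x ≤ 6 * spans x) ws≡
                                                 (reduce-time rs _ (duval-bounded (c ∷ s)) ps) ⟩
    6 * spans (c ∷ s)                       ∎
    where
    open ≤-Reasoning
    τ ρ : ℕ
    τ = time (duval (c ∷ s))
    ρ = time (reduce rs (value (duval (c ∷ s))) (duval-bounded (c ∷ s)))

  -- The term with 4 carries the cost of the call of `duval` that produced the factors. Each factor
  -- pays its share out of its own span, and the spans of its proper suffixes pay for the recursion.
  reduce-time : ∀ {n} (rs : ∀ {m} → m < n → Acc _<_ m) ws (bs : Bounded n ws) →
    All (LeadingRunLongest ∘ letters) ws →
    time (reduce rs ws bs) + 4 * length (concat (map letters ws)) ≤ 6 * spans (concat (map letters ws))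
  reduce-time rs []              []       []       = z≤n
  reduce-time rs ((c ∷ w) ∷ ws) (q ∷ qs) (p ∷ ps) = begin
    2 + (τ + (ρ + 0)) + 4 * length (c ∷ w ++ x)
      ≡⟨ cong (λ l → 2 + (τ + (ρ + 0)) + 4 * suc l) (length-++ w) ⟩
    2 + (τ + (ρ + 0)) + 4 * suc (length w + length x)
      ≡⟨ eq τ ρ (length w) (length x) ⟩
    (2 + 4 * suc (length w)) + τ + (ρ + 4 * length x)
      ≤⟨ +-mono-≤ (+-mono-≤ step (rduval-time w (rs q))) (reduce-time rs ws qs ps) ⟩
    6 * span 0 (c ∷ w) + 6 * spans w + 6 * spans x
      ≡⟨ eq′ (span 0 (c ∷ w)) (spans w) (spans x) ⟩
    6 * (spans (c ∷ w) + spans x)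
      ≤⟨ *-monoʳ-≤ 6 (spans-++ (c ∷ w) x) ⟩
    6 * spans (c ∷ w ++ x) ∎
    where
    open ≤-Reasoning
    x = concat (map letters ws)
    τ ρ : ℕ
    τ = time (rduval w (rs q))
    ρ = time (reduce rs ws qs)
    eq : ∀ τ ρ l m → 2 + (τ + (ρ + 0)) + 4 * suc (l + m) ≡ (2 + 4 * suc l) + τ + (ρ + 4 * m)
    eq = solve-∀
    eq′ : ∀ k l m → 6 * k + 6 * l + 6 * m ≡ 6 * (k + l + m)
    eq′ = solve-∀
    step : 2 + 4 * suc (length w) ≤ 6 * span 0 (c ∷ w)
    step = begin
      2 + 4 * suc (length w)                      ≤⟨ m≤n+m _ (2 * length w) ⟩
      2 * length w + (2 + 4 * suc (length w))     ≡⟨ eq″ (length w) ⟩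
      6 * suc (length w)                          ≤⟨ *-monoʳ-≤ 6 p ⟩
      6 * span 0 (c ∷ w)                          ∎
      where
      eq″ : ∀ l → 2 * l + (2 + 4 * suc l) ≡ 6 * suc l
      eq″ = solve-∀

-- Sums over all words of a given length

-- This is `2 ^ n` times the mean of `f`, so that expectations are compared in ℕ.
total : (Word → ℕ) → ℕ → ℕ
total f n = sum (map f (words n))

total-suc : ∀ f n → total f (suc n) ≡ total (f ∘ (a ∷_)) n + total (f ∘ (b ∷_)) n
total-suc f n = begin
  sum (map f (map (a ∷_) (words n) ++ map (b ∷_) (words n)))
    ≡⟨ cong sum (map-++ f (map (a ∷_) (words n)) _) ⟩
  sum (map f (map (a ∷_) (words n)) ++ map f (map (b ∷_) (words n)))
    ≡⟨ sum-++ (map f (map (a ∷_) (words n))) _ ⟩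
  sum (map f (map (a ∷_) (words n))) + sum (map f (map (b ∷_) (words n)))
    ≡⟨ cong₂ (λ l m → sum l + sum m) (map-∘ (words n)) (map-∘ (words n)) ⟨
  total (f ∘ (a ∷_)) n + total (f ∘ (b ∷_)) n ∎
  where open ≡-Reasoning

total-mono : ∀ {f g} → (∀ x → f x ≤ g x) → ∀ n → total f n ≤ total g n
total-mono {f} {g} f≤g n = go (words n)
  where
  go : ∀ xs → sum (map f xs) ≤ sum (map g xs)
  go []       = z≤n
  go (x ∷ xs) = +-mono-≤ (f≤g x) (go xs)

total-+ : ∀ f g n → total (λ x → f x + g x) n ≡ total f n + total g n
total-+ f g n = go (words n)
  where
  eq : ∀ i j k l → i + j + (k + l) ≡ i + k + (j + l)
  eq = solve-∀
  go : ∀ xs → sum (map (λ x → f x + g x) xs) ≡ sum (map f xs) + sum (map g xs)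
  go []       = refl
  go (x ∷ xs) = trans (cong (f x + g x +_) (go xs)) (eq (f x) (g x) _ _)

total-* : ∀ c f n → total (λ x → c * f x) n ≡ c * total f n
total-* c f n = go (words n)
  where
  go : ∀ xs → sum (map (λ x → c * f x) xs) ≡ c * sum (map f xs)
  go []       = sym (*-zeroʳ c)
  go (x ∷ xs) = trans (cong (c * f x +_) (go xs)) (sym (*-distribˡ-+ c (f x) _))

total-const : ∀ c n → total (λ _ → c) n ≡ c * 2 ^ n
total-const c zero    = trans (+-identityʳ c) (sym (*-identityʳ c))
total-const c (suc n) = begin
  total (λ _ → c) (suc n)     ≡⟨ total-suc _ n ⟩
  total (λ _ → c) n + total (λ _ → c) n  ≡⟨ cong (λ m → m + m) (total-const c n) ⟩
  c * 2 ^ n + c * 2 ^ n       ≡⟨ eq c (2 ^ n) ⟩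
  c * 2 ^ suc n               ∎
  where
  open ≡-Reasoning
  eq : ∀ c m → c * m + c * m ≡ c * (2 * m)
  eq = solve-∀

total-1+ : ∀ f n → total (suc ∘ f) n ≡ 2 ^ n + total f n
total-1+ f n = trans (total-+ (λ _ → 1) f n)
  (cong (_+ total f n) (trans (total-const 1 n) (*-identityˡ (2 ^ n))))

run≤length : ∀ K r y → run K r y ≤ length y
run≤length K r       []      = z≤n
run≤length K zero    (a ∷ y) = z≤n
run≤length K (suc r) (a ∷ y) = s≤s (run≤length K r y)
run≤length K zero    (b ∷ y) = s≤s (run≤length K K y)
run≤length K (suc r) (b ∷ y) = s≤s (run≤length K K y)

span≤length : ∀ m y → span m y ≤ length y
span≤length m []      = z≤n
span≤length m (a ∷ y) = s≤s (span≤length (suc m) y)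
span≤length m (b ∷ y) = s≤s (run≤length m m y)

total-length : ∀ n → total length n ≡ n * 2 ^ n
total-length zero    = refl
total-length (suc n) = begin
  total length (suc n)                        ≡⟨ total-suc length n ⟩
  total (suc ∘ length) n + total (suc ∘ length) n ≡⟨ cong (λ m → m + m) (total-1+ length n) ⟩
  (2 ^ n + total length n) + (2 ^ n + total length n)
                                              ≡⟨ cong (λ m → (2 ^ n + m) + (2 ^ n + m)) (total-length n) ⟩
  (2 ^ n + n * 2 ^ n) + (2 ^ n + n * 2 ^ n)   ≡⟨ eq n (2 ^ n) ⟩
  suc n * 2 ^ suc n                           ∎
  where
  open ≡-Reasoning
  eq : ∀ n m → (m + n * m) + (m + n * m) ≡ suc n * (2 * m)
  eq = solve-∀

-- Expected runs and spans

-- In fair coin tosses, the expected waiting time for a run longer than K is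
-- 2 ^ (2 + K) − 2 ^ (1 + s) when r = K − s more a's are allowed.
total-run : ∀ K r s n → K ≡ r + s → total (run K r) n + 2 ^ suc s * 2 ^ n ≤ 2 ^ (2 + K) * 2 ^ n
total-run K r s zero refl = *-monoˡ-≤ 1 (^-monoʳ-≤ 2 (s≤s (≤-trans (m≤n+m s r) (n≤1+n _))))
total-run K zero s (suc n) refl = begin
  total (run K 0) (suc n) + Q * (2 * N)   ≡⟨ cong (_+ Q * (2 * N)) (trans (total-suc (run K 0) n)
                                               (cong₂ _+_ (total-const 0 n) (total-1+ (run K K) n))) ⟩
  -- The spare `N` completes the `2 * N` needed by the bound for a fresh run.
  0 + (N + B) + Q * (2 * N)               ≤⟨ m≤m+n _ N ⟩
  N + B + Q * (2 * N) + N                 ≡⟨ eq N B Q ⟩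
  (B + 2 * N) + 2 * Q * N                 ≤⟨ +-monoˡ-≤ (2 * Q * N) (total-run K K 0 n (sym (+-identityʳ K))) ⟩
  2 * Q * N + 2 * Q * N                   ≡⟨ eq′ N Q ⟩
  2 * Q * (2 * N)                         ∎
  where
  open ≤-Reasoning
  N Q B : ℕ
  N = 2 ^ n
  Q = 2 ^ suc s
  B = total (run K K) n
  eq : ∀ N B Q → N + B + Q * (2 * N) + N ≡ (B + 2 * N) + 2 * Q * N
  eq = solve-∀
  eq′ : ∀ N Q → 2 * Q * N + 2 * Q * N ≡ 2 * Q * (2 * N)
  eq′ = solve-∀
total-run K (suc r) s (suc n) K≡ = begin
  total (run K (suc r)) (suc n) + Q * (2 * N)   ≡⟨ cong (_+ Q * (2 * N)) (trans (total-suc (run K (suc r)) n)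
                                               (cong₂ _+_ (total-1+ (run K r) n) (total-1+ (run K K) n))) ⟩
  (N + A′) + (N + B) + Q * (2 * N)              ≡⟨ eq N A′ B Q ⟩
  -- After an a, one a fewer is allowed and `s` grows by 1; after a b, the count restarts with
  -- `r = K` and `s = 0`.
  (A′ + 2 * Q * N) + (B + 2 * N)                ≤⟨ +-mono-≤ (total-run K r (suc s) n (trans K≡ (sym (+-suc r s))))
                                                           (total-run K K 0 n (sym (+-identityʳ K))) ⟩
  R * N + R * N                                 ≡⟨ eq′ N R ⟩
  R * (2 * N)                                   ∎
  where
  open ≤-Reasoning
  N Q A′ B R : ℕ
  N  = 2 ^ n
  Q  = 2 ^ suc s
  A′ = total (run K r) n
  B  = total (run K K) n
  R  = 2 ^ (2 + K)
  eq : ∀ N A B Q → (N + A) + (N + B) + Q * (2 * N) ≡ (A + 2 * Q * N) + (B + 2 * N)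
  eq = solve-∀
  eq′ : ∀ N R → R * N + R * N ≡ R * (2 * N)
  eq′ = solve-∀

-- For m = 0: each length below t of the leading run contributes at most 2 to the
-- average of span; a longer one has probability 2 ^ (− t) and contributes at most N.
total-span : ∀ t m n {N} → n ≤ N →
  2 ^ t * total (span m) n ≤ 2 ^ n * (2 * t * 2 ^ t * 2 ^ m + N)
total-span zero m n {N} n≤N = begin
  1 * total (span m) n    ≡⟨ *-identityˡ _ ⟩
  total (span m) n        ≤⟨ total-mono (span≤length m) n ⟩
  total length n          ≡⟨ total-length n ⟩
  n * 2 ^ n               ≤⟨ *-monoˡ-≤ (2 ^ n) n≤N ⟩
  N * 2 ^ n               ≡⟨ *-comm N (2 ^ n) ⟩
  2 ^ n * N               ∎
  where open ≤-Reasoning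
total-span (suc t) m zero n≤N = ≤-trans (≤-reflexive (*-zeroʳ (2 ^ suc t))) z≤n
total-span (suc t) m (suc n) {N} n<N = begin
  2 * T * total (span m) (suc n)
    ≡⟨ cong (2 * T *_) (trans (total-suc (span m) n)
         (cong₂ _+_ (total-1+ (span (suc m)) n) (total-1+ (run m m) n))) ⟩
  2 * T * ((P + L) + (P + W))
    ≡⟨ eq T P L W ⟩
  2 * (T * L) + 2 * T * (W + 2 * P)
    -- A leading a moves one unit from `t` to `m`, which keeps `2 ^ t * 2 ^ m`; a leading b fixes
    -- the bound `m`, and a fresh run is awaited.
    ≤⟨ +-mono-≤ (*-monoʳ-≤ 2 (total-span t (suc m) n (<⇒≤ n<N)))
         (*-monoʳ-≤ (2 * T) (total-run m m 0 n (sym (+-identityʳ m)))) ⟩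
  2 * (P * (2 * t * T * (2 * M) + N)) + 2 * T * (2 * (2 * M) * P)
    ≡⟨ eq′ t T P M N ⟩
  2 * P * (2 * suc t * (2 * T) * M + N) ∎
  where
  open ≤-Reasoning
  T P M L W : ℕ
  T = 2 ^ t
  P = 2 ^ n
  M = 2 ^ m
  L = total (span (suc m)) n
  W = total (run m m) n
  eq : ∀ T P L W → 2 * T * ((P + L) + (P + W)) ≡ 2 * (T * L) + 2 * T * (W + 2 * P)
  eq = solve-∀
  eq′ : ∀ t T P M N → 2 * (P * (2 * t * T * (2 * M) + N)) + 2 * T * (2 * (2 * M) * P) ≡
                      2 * P * (2 * suc t * (2 * T) * M + N)
  eq′ = solve-∀

-- With N = `2 ^ t`, the long leading runs together contribute at most 1 to the mean.
total-span-log : ∀ t n → n ≤ 2 ^ t → total (span 0) n ≤ suc (2 * t) * 2 ^ n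
total-span-log t n n≤2^t = *-cancelˡ-≤ (2 ^ t) {{m^n≢0 2 t}} (begin
  2 ^ t * total (span 0) n               ≤⟨ total-span t 0 n n≤2^t ⟩
  2 ^ n * (2 * t * 2 ^ t * 1 + 2 ^ t)    ≡⟨ eq (2 ^ n) t (2 ^ t) ⟩
  2 ^ t * (suc (2 * t) * 2 ^ n)          ∎)
  where
  open ≤-Reasoning
  eq : ∀ P t T → P * (2 * t * T * 1 + T) ≡ T * (suc (2 * t) * P)
  eq = solve-∀

-- Removing the first letter from all words of length `suc n` gives each word of length `n` twice.
-- One `t` serves all suffixes, as they are no longer than the word.
total-spans : ∀ t n → n ≤ 2 ^ t → total spans n ≤ n * suc (2 * t) * 2 ^ n
total-spans t zero    n≤2^t = z≤n
total-spans t (suc n) n<2^t = begin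
  total spans (suc n)
    ≡⟨ total-suc spans n ⟩
  total (spans ∘ (a ∷_)) n + total (spans ∘ (b ∷_)) n
    ≡⟨ cong₂ _+_ (total-+ (span 0 ∘ (a ∷_)) spans n) (total-+ (span 0 ∘ (b ∷_)) spans n) ⟩
  (total (span 0 ∘ (a ∷_)) n + S) + (total (span 0 ∘ (b ∷_)) n + S)
    ≡⟨ eq (total (span 0 ∘ (a ∷_)) n) (total (span 0 ∘ (b ∷_)) n) S ⟩
  total (span 0 ∘ (a ∷_)) n + total (span 0 ∘ (b ∷_)) n + 2 * S
    ≡⟨ cong (_+ 2 * S) (total-suc (span 0) n) ⟨
  total (span 0) (suc n) + 2 * S
    ≤⟨ +-mono-≤ (total-span-log t (suc n) n<2^t) (*-monoʳ-≤ 2 (total-spans t n (<⇒≤ n<2^t))) ⟩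
  suc (2 * t) * 2 ^ suc n + 2 * (n * suc (2 * t) * 2 ^ n)
    ≡⟨ eq′ (suc (2 * t)) (2 ^ n) n ⟩
  suc n * suc (2 * t) * 2 ^ suc n ∎
  where
  open ≤-Reasoning
  S = total spans n
  eq : ∀ i j S → (i + S) + (j + S) ≡ i + j + 2 * S
  eq = solve-∀
  eq′ : ∀ u P n → u * (2 * P) + 2 * (n * u * P) ≡ suc n * u * (2 * P)
  eq′ = solve-∀

total-time : ∀ t n → n ≤ 2 ^ t → total (time ∘ RDuval) n ≤ suc (2 * t) * (6 * n * 2 ^ n)
total-time t n n≤2^t = begin
  total (time ∘ RDuval) n              ≤⟨ total-mono (λ x → rduval-time x _) n ⟩
  total (λ x → 6 * spans x) n          ≡⟨ total-* 6 spans n ⟩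
  6 * total spans n                    ≤⟨ *-monoʳ-≤ 6 (total-spans t n n≤2^t) ⟩
  6 * (n * suc (2 * t) * 2 ^ n)        ≡⟨ eq n (suc (2 * t)) (2 ^ n) ⟩
  suc (2 * t) * (6 * n * 2 ^ n)        ∎
  where
  open ≤-Reasoning
  eq : ∀ n u P → 6 * (n * u * P) ≡ u * (6 * n * P)
  eq = solve-∀

-- From binary logarithms to the stated bound

logarithm : ∀ n → 1 ≤ n → ∃[ t ] n ≤ 2 ^ t × 2 ^ t ≤ 2 * n
logarithm 1             _ = 0 , s≤s z≤n , s≤s z≤n
logarithm (suc n@(suc _)) _ with logarithm n (s≤s z≤n)
... | t , n≤ , ≤2n with suc n ≤? 2 ^ t
...   | yes n<  = t , n< , ≤-trans ≤2n (*-monoʳ-≤ 2 (n≤1+n n))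
...   | no  n≮  = suc t , (begin
    suc n               ≤⟨ +-monoˡ-≤ n (s≤s z≤n) ⟩
    n + n               ≤⟨ +-mono-≤ n≤ n≤ ⟩
    2 ^ t + 2 ^ t       ≡⟨ cong (2 ^ t +_) (+-identityʳ (2 ^ t)) ⟨
    2 * 2 ^ t           ∎) , *-monoʳ-≤ 2 (≤-trans (≮⇒≥ n≮) (n≤1+n n))
  where open ≤-Reasoning

-- 4/3 ≤ 2, so it suffices to bound the binary logarithm.
≤-log : ∀ p d .{{_ : NonZero d}} m n → 2 ^ p ≤ n ^ (m * d) → (ℤ.+ p) / d ≤ m ·log[4/3] n
≤-log p (suc d) m n 2^p≤ = begin
  4 ^ p             ≡⟨ ^-*-assoc 2 2 p ⟩
  2 ^ (2 * p)       ≡⟨ cong (λ k → 2 ^ (p + k)) (+-identityʳ p) ⟩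
  2 ^ (p + p)       ≡⟨ ^-distribˡ-+-* 2 p p ⟩
  2 ^ p * 2 ^ p     ≤⟨ *-mono-≤ (^-monoˡ-≤ p (n≤1+n 2)) 2^p≤ ⟩
  3 ^ p * n ^ (m * suc d) ∎
  where open ≤-Reasoning

-- One factor n absorbs the 2, and each `2 ^ t` is at most 2n ≤ n².
2^[1+2t]≤n^5 : ∀ t n → 2 ≤ n → 2 ^ t ≤ 2 * n → 2 ^ suc (2 * t) ≤ n ^ 5
2^[1+2t]≤n^5 t n 2≤n 2^t≤ = begin
  2 * 2 ^ (2 * t)                ≡⟨ cong (λ k → 2 * 2 ^ (t + k)) (+-identityʳ t) ⟩
  2 * 2 ^ (t + t)                ≡⟨ cong (2 *_) (^-distribˡ-+-* 2 t t) ⟩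
  2 * (2 ^ t * 2 ^ t)            ≤⟨ *-mono-≤ 2≤n (*-mono-≤ 2^t≤n² 2^t≤n²) ⟩
  n * (n * n * (n * n))          ≡⟨ eq n ⟩
  n ^ 5                          ∎
  where
  open ≤-Reasoning
  2^t≤n² : 2 ^ t ≤ n * n
  2^t≤n² = ≤-trans 2^t≤ (*-monoˡ-≤ n 2≤n)
  eq : ∀ n → n * (n * n * (n * n)) ≡ n * (n * (n * (n * (n * 1))))
  eq = solve-∀

lemma7 : ∃[ c ] ∃[ n₀ ] ((n : ℕ) → n ≥ n₀ → averageTime n ≤ (c * n) ·log[4/3] n)
-- 30 is 6 from `rduval-time` times the exponent 5 above. At n = 1 the logarithm vanishes while the
-- time does not, so n starts at 2.
lemma7 = 30 , 2 , λ n 2≤n → average≤ n 2≤n (logarithm n (<⇒≤ 2≤n))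
  where
  average≤ : ∀ n → 2 ≤ n → ∃[ t ] n ≤ 2 ^ t × 2 ^ t ≤ 2 * n → averageTime n ≤ (30 * n) ·log[4/3] n
  average≤ n 2≤n (t , n≤2^t , 2^t≤2n) =
    ≤-log (total (time ∘ RDuval) n) (2 ^ n) {{m^n≢0 2 n}} (30 * n) n (begin
      2 ^ total (time ∘ RDuval) n                ≤⟨ ^-monoʳ-≤ 2 (total-time t n n≤2^t) ⟩
      2 ^ (suc (2 * t) * (6 * n * 2 ^ n))        ≡⟨ ^-*-assoc 2 (suc (2 * t)) (6 * n * 2 ^ n) ⟨
      (2 ^ suc (2 * t)) ^ (6 * n * 2 ^ n)        ≤⟨ ^-monoˡ-≤ (6 * n * 2 ^ n) (2^[1+2t]≤n^5 t n 2≤n 2^t≤2n) ⟩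
      (n ^ 5) ^ (6 * n * 2 ^ n)                  ≡⟨ ^-*-assoc n 5 (6 * n * 2 ^ n) ⟩
      n ^ (5 * (6 * n * 2 ^ n))                  ≡⟨ cong (n ^_) (eq n (2 ^ n)) ⟩
      n ^ (30 * n * 2 ^ n)                       ∎)
    where
    open ≤-Reasoning
    eq : ∀ n P → 5 * (6 * n * P) ≡ 30 * n * P
    eq = solve-∀
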